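{- The matrix $$A=\begin{pmatrix}1&2&0\\0&1&2\\-7&0&29\end{pmatrix}$$ is not of Frobenius type.
   Context: $M(3,\mathbb{Z})$ denotes the set of $3\times 3$ matrices with integer entries whose characteristic polynomial is irreducible over $\mathbb{Q}$. For integers $a_1,a_2,a_3$, the Frobenius matrix is $$M_{a_1,a_2,a_3}=\begin{pmatrix} 0 & 1 & 0 \\ 0 & 0 & 1 \\ a_3 & a_2 & a_1 \end{pmatrix}.$$ A matrix $A\in M(3,\mathbb{Z})$ is said to be of Frobenius type if there exist integers $a_1,a_2,a_3$ and a matrix $X\in SL(3,\mathbb{Z})$ such that $XAX^{ -1}$ commutes with $M_{a_1,a_2,a_3}$. -}

module Defs where

open import Algebra.Bundles.Raw using (RawRing)
import Algebra.Definitions.RawSemiring as SemiringDefs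
open import Data.Fin.Base using (Fin; zero; suc; toℕ; punchIn)
open import Data.Integer.Base as ℤ using (ℤ; +_; -[1+_])
open import Data.List.Base as List using (List; []; _∷_)
open import Data.Nat.Base using (ℕ; zero; suc)
open import Data.Product.Base using (Σ-syntax; ∃-syntax; _×_; proj₁)
open import Data.Rational.Base as ℚ using (ℚ; 0ℚ; 1ℚ)
open import Data.Vec.Functional as Vector using (Vector)
open import Level using (0ℓ)
open import Relation.Binary.PropositionalEquality.Core using (_≡_)

Matrix : Set → ℕ → Set
Matrix A n = Vector (Vector A n) n

module MatrixOps (R : RawRing 0ℓ 0ℓ) where
  open RawRing R
  open SemiringDefs rawSemiring using (sum; _^_)

  infix  4 _≋_
  infixl 7 _⊗_

  _≋_ : ∀ {n} → Matrix Carrier n → Matrix Carrier n → Set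
  A ≋ B = ∀ i j → A i j ≈ B i j

  _⊗_ : ∀ {n} → Matrix Carrier n → Matrix Carrier n → Matrix Carrier n
  (A ⊗ B) i j = sum (λ k → A i k * B k j)

  Id : ∀ {n} → Matrix Carrier n
  Id zero    zero    = 1#
  Id zero    (suc _) = 0#
  Id (suc _) zero    = 0#
  Id (suc i) (suc j) = Id i j

  -- Laplace expansion along the first row.
  det : ∀ {n} → Matrix Carrier n → Carrier
  det {zero}  A = 1#
  det {suc n} A =
    sum (λ j → (- 1#) ^ toℕ j * (A zero j * det (λ r c → A (suc r) (punchIn j c))))

  Commute : ∀ {n} → Matrix Carrier n → Matrix Carrier n → Set
  Commute A B = A ⊗ B ≋ B ⊗ A

  Inverse : ∀ {n} → Matrix Carrier n → Matrix Carrier n → Set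
  Inverse A B = (A ⊗ B ≋ Id) × (B ⊗ A ≋ Id)

-- The ring ℚ[x]: a polynomial is a list of coefficients, constant term first.
-- Trailing zeros are allowed, so equality of polynomials is _≈ₚ_ and not _≡_.
Poly : Set
Poly = List ℚ

coeff : Poly → ℕ → ℚ
coeff []      _       = 0ℚ
coeff (a ∷ _) zero    = a
coeff (_ ∷ p) (suc k) = coeff p k

infix  4 _≈ₚ_
infixl 6 _+ₚ_
infixl 7 _*ₚ_

_≈ₚ_ : Poly → Poly → Set
p ≈ₚ q = ∀ k → coeff p k ≡ coeff q k

_+ₚ_ : Poly → Poly → Poly
[]      +ₚ q       = q
(a ∷ p) +ₚ []      = a ∷ p
(a ∷ p) +ₚ (b ∷ q) = (a ℚ.+ b) ∷ (p +ₚ q)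

_*ₚ_ : Poly → Poly → Poly
[]      *ₚ q = []
(a ∷ p) *ₚ q = List.map (a ℚ.*_) q +ₚ (0ℚ ∷ p *ₚ q)

polyRing : RawRing 0ℓ 0ℓ
polyRing = record
  { Carrier = Poly
  ; _≈_     = _≈ₚ_
  ; _+_     = _+ₚ_
  ; _*_     = _*ₚ_
  ; -_      = List.map (λ a → ℚ.- a)
  ; 0#      = []
  ; 1#      = 1ℚ ∷ []
  }

module ℤMat = MatrixOps ℤ.+-*-rawRing
module PolyMat = MatrixOps polyRing

open SemiringDefs (RawRing.rawSemiring polyRing) public using (Irreducible)

-- det (x I - A)
charPoly : ∀ {n} → Matrix ℤ n → Poly
charPoly A = PolyMat.det (λ i j → X *ₚ PolyMat.Id i j +ₚ constant (ℤ.- A i j))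
  where
  X : Poly
  X = 0ℚ ∷ 1ℚ ∷ []

  constant : ℤ → Poly
  constant a = (a ℚ./ 1) ∷ []

-- The set M(3,ℤ): irreducibility of the characteristic polynomial is part of
-- membership.
M[3,ℤ] : Set
M[3,ℤ] = Σ[ A ∈ Matrix ℤ 3 ] Irreducible (charPoly A)

matrix₃ : (a b c d e f g h i : ℤ) → Matrix ℤ 3
matrix₃ a b c d e f g h i = row a b c Vector.∷ row d e f Vector.∷ row g h i Vector.∷ Vector.[]
  where
  row : ℤ → ℤ → ℤ → Vector ℤ 3
  row x y z = x Vector.∷ y Vector.∷ z Vector.∷ Vector.[]

frobenius : (a₁ a₂ a₃ : ℤ) → Matrix ℤ 3
frobenius a₁ a₂ a₃ = matrix₃
  (+ 0) (+ 1) (+ 0)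
  (+ 0) (+ 0) (+ 1)
  a₃    a₂    a₁

-- X⁻¹ is carried along as the two-sided inverse of X; for det X = 1 it exists
-- over ℤ and is unique.
FrobeniusType : M[3,ℤ] → Set
FrobeniusType A =
  ∃[ a₁ ] ∃[ a₂ ] ∃[ a₃ ] ∃[ X ] ∃[ X⁻¹ ]
    det X ≡ + 1 × Inverse X X⁻¹ ×
    Commute (X ⊗ proj₁ A ⊗ X⁻¹) (frobenius a₁ a₂ a₃)
  where open ℤMat

A₀ : Matrix ℤ 3
A₀ = matrix₃
  (+ 1)    (+ 2) (+ 0)
  (+ 0)    (+ 1) (+ 2)
  -[1+ 6 ] (+ 0) (+ 29)

module Submission where

-- Conjugating back, N = X⁻¹ M X commutes with A₀ and X N = M X, so the rows of X are x, xN, xN² for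
-- the first row x of X. The integer matrices commuting with A₀ form a rank-three order, in which N
-- has coordinates (a, s, m), and det (x, xN, xN²) = F(s, m) G(x) with F(s, m) = 2m³ - 28sm² + 7s³
-- the index form of that order. As cubes are 0 or ±1 modulo 7, F ≡ 2m³ is never ±1, so det X ≠ 1.
-- The characteristic polynomial is a cubic without a root modulo 3, even at infinity.

open import Defs
open import Algebra.Bundles using (Monoid; module AbelianGroup)
open import Algebra.Bundles.Raw using (RawRing; module RawRing)
open import Algebra.Definitions.RawMagma (RawRing.*-rawMagma polyRing) using (_,_)
import Algebra.Definitions.RawSemiring as SemiringDefs
import Algebra.Properties.Group as GroupProperties
import Algebra.Properties.Monoid as MonoidProperties
import Algebra.Properties.Semiring.Sum as SemiringSum
open import Data.Fin.Base as Fin using (Fin; zero; suc; toℕ; fromℕ<; punchIn)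
open import Data.Fin.Patterns using (0F; 1F; 2F)
import Data.Fin.Properties as Finₚ
open import Data.Integer.Base as ℤ using (ℤ; +_; -[1+_])
import Data.Integer.DivMod as ℤDivMod
open import Data.Integer.Divisibility.Signed
  using (_∣_; _∣?_; ∣⇒∣ᵤ; divides; ∣m∣n⇒∣m+n; ∣m⇒∣-m; ∣m⇒∣m*n; ∣n⇒∣m*n)
import Data.Integer.Properties as ℤₚ
import Data.Integer.Solver as ℤSolver
open import Data.List.Base using (List; []; _∷_; map)
open import Data.Nat.Base as ℕ using (ℕ; zero; suc; _<_; z<s; s<s)
import Data.Nat.Coprimality as Coprimality
import Data.Nat.Properties as ℕₚ
open import Data.Product.Base using (Σ-syntax; ∃-syntax; _×_; _,_; proj₁; proj₂; uncurry)
open import Data.Rational.Base as ℚ using (ℚ; mkℚ; 0ℚ; 1ℚ)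
open import Data.Rational.Literals using (fromℤ)
import Data.Rational.Properties as ℚₚ
import Data.Rational.Solver as ℚSolver
import Data.Rational.Unnormalised.Base as ℚᵘ
import Data.Rational.Unnormalised.Properties as ℚᵘₚ
open import Data.Sum.Base using (_⊎_; inj₁; inj₂)
open import Data.Vec.Base as Vec using (Vec)
import Data.Vec.Properties as Vecₚ
open import Function.Base using (_∘_; id)
open import Level using (0ℓ)
import Relation.Binary.Reasoning.Setoid as SetoidReasoning
open import Relation.Binary.PropositionalEquality
  using (_≡_; _≢_; refl; sym; trans; cong; cong₂; subst; module ≡-Reasoning)
open import Relation.Nullary.Decidable using (yes; no; from-yes; ¬?; _→-dec_; _×-dec_)
open import Relation.Nullary.Negation.Core using (¬_; contradiction)
import Tactic.MonoidSolver as MonoidSolver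

open SemiringDefs (RawRing.rawSemiring polyRing) using () renaming (_∣_ to _∣ₚ_)

-- Polynomials over ℚ

eval : Poly → ℚ → ℚ
eval []      r = 0ℚ
eval (a ∷ p) r = a ℚ.+ r ℚ.* eval p r

eval-zero : ∀ p r → p ≈ₚ [] → eval p r ≡ 0ℚ
eval-zero []      r p≈0 = refl
eval-zero (a ∷ p) r p≈0
  rewrite p≈0 0 | eval-zero p r (λ k → p≈0 (suc k)) = trans (ℚₚ.+-identityˡ _) (ℚₚ.*-zeroʳ r)

eval-cong : ∀ {p q} r → p ≈ₚ q → eval p r ≡ eval q r
eval-cong {[]}    {q}     r p≈q = sym (eval-zero q r (λ k → sym (p≈q k)))
eval-cong {a ∷ p} {[]}    r p≈q = eval-zero (a ∷ p) r p≈q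
eval-cong {a ∷ p} {b ∷ q} r p≈q =
  cong₂ (λ x y → x ℚ.+ r ℚ.* y) (p≈q 0) (eval-cong {p} {q} r (λ k → p≈q (suc k)))

eval-scale : ∀ a p r → eval (map (a ℚ.*_) p) r ≡ a ℚ.* eval p r
eval-scale a []      r = sym (ℚₚ.*-zeroʳ a)
eval-scale a (b ∷ p) r rewrite eval-scale a p r =
  solve 4 (λ a b r e → a :* b :+ r :* (a :* e) := a :* (b :+ r :* e)) refl a b r (eval p r)
  where open ℚSolver.+-*-Solver

eval-+ₚ : ∀ p q r → eval (p +ₚ q) r ≡ eval p r ℚ.+ eval q r
eval-+ₚ []      q       r = sym (ℚₚ.+-identityˡ _)
eval-+ₚ (a ∷ p) []      r = sym (ℚₚ.+-identityʳ _)
eval-+ₚ (a ∷ p) (b ∷ q) r rewrite eval-+ₚ p q r =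
  solve 5 (λ a b r e f → a :+ b :+ r :* (e :+ f) := (a :+ r :* e) :+ (b :+ r :* f)) refl
    a b r (eval p r) (eval q r)
  where open ℚSolver.+-*-Solver

eval-*ₚ : ∀ p q r → eval (p *ₚ q) r ≡ eval p r ℚ.* eval q r
eval-*ₚ []      q r = sym (ℚₚ.*-zeroˡ (eval q r))
eval-*ₚ (a ∷ p) q r
  rewrite eval-+ₚ (map (a ℚ.*_) q) (0ℚ ∷ p *ₚ q) r | eval-scale a q r | eval-*ₚ p q r =
  solve 4 (λ a r e f → a :* f :+ (con 0ℚ :+ r :* (e :* f)) := (a :+ r :* e) :* f) refl
    a r (eval p r) (eval q r)
  where open ℚSolver.+-*-Solver

coeff-+ₚ : ∀ p q k → coeff (p +ₚ q) k ≡ coeff p k ℚ.+ coeff q k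
coeff-+ₚ []      q       k       = sym (ℚₚ.+-identityˡ _)
coeff-+ₚ (a ∷ p) []      k       = sym (ℚₚ.+-identityʳ _)
coeff-+ₚ (a ∷ p) (b ∷ q) zero    = refl
coeff-+ₚ (a ∷ p) (b ∷ q) (suc k) = coeff-+ₚ p q k

coeff-scale : ∀ a p k → coeff (map (a ℚ.*_) p) k ≡ a ℚ.* coeff p k
coeff-scale a []      k       = sym (ℚₚ.*-zeroʳ a)
coeff-scale a (b ∷ p) zero    = refl
coeff-scale a (b ∷ p) (suc k) = coeff-scale a p k

coeff-∷-*ₚ : ∀ a p q k →
  coeff ((a ∷ p) *ₚ q) k ≡ a ℚ.* coeff q k ℚ.+ coeff (0ℚ ∷ p *ₚ q) k
coeff-∷-*ₚ a p q k = trans (coeff-+ₚ (map (a ℚ.*_) q) (0ℚ ∷ p *ₚ q) k)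
  (cong (ℚ._+ coeff (0ℚ ∷ p *ₚ q) k) (coeff-scale a q k))

*ₚ-zeroˡ : ∀ p q → p ≈ₚ [] → p *ₚ q ≈ₚ []
*ₚ-zeroˡ []      q p≈0 k = refl
*ₚ-zeroˡ (a ∷ p) q p≈0 k = begin
  coeff ((a ∷ p) *ₚ q) k                    ≡⟨ coeff-∷-*ₚ a p q k ⟩
  a ℚ.* coeff q k ℚ.+ coeff (0ℚ ∷ p *ₚ q) k ≡⟨ cong₂ (λ x y → x ℚ.* coeff q k ℚ.+ y) (p≈0 0) (shifted k) ⟩
  0ℚ ℚ.* coeff q k ℚ.+ 0ℚ                   ≡⟨ ℚₚ.+-identityʳ _ ⟩
  0ℚ ℚ.* coeff q k                          ≡⟨ ℚₚ.*-zeroˡ (coeff q k) ⟩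
  0ℚ                                        ∎
  where
  open ≡-Reasoning
  shifted : ∀ k → coeff (0ℚ ∷ p *ₚ q) k ≡ 0ℚ
  shifted zero    = refl
  shifted (suc k) = *ₚ-zeroˡ p q (λ k → p≈0 (suc k)) k

DegreeAtMost : ℕ → Poly → Set
DegreeAtMost d p = ∀ k → d < k → coeff p k ≡ 0ℚ

-- Induction on the bound for `p`. At bound 0 the tail of `p` is the zero polynomial, so only the
-- scaled copy of `q` contributes. Otherwise that copy has degree at most `e` and vanishes at the
-- top position, and the tail of `p` satisfies the bound lowered by one.
coeff-top-*ₚ : ∀ p q {d e} → DegreeAtMost d p → DegreeAtMost e q →
  coeff (p *ₚ q) (d ℕ.+ e) ≡ coeff p d ℚ.* coeff q e
coeff-top-*ₚ []      q {d}     {e} _     _     = sym (ℚₚ.*-zeroˡ (coeff q e))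
coeff-top-*ₚ (a ∷ p) q {zero}  {e} deg-p deg-q = begin
  coeff ((a ∷ p) *ₚ q) e                    ≡⟨ coeff-∷-*ₚ a p q e ⟩
  a ℚ.* coeff q e ℚ.+ coeff (0ℚ ∷ p *ₚ q) e ≡⟨ cong (a ℚ.* coeff q e ℚ.+_) (shifted e) ⟩
  a ℚ.* coeff q e ℚ.+ 0ℚ                    ≡⟨ ℚₚ.+-identityʳ _ ⟩
  a ℚ.* coeff q e                           ∎
  where
  open ≡-Reasoning
  shifted : ∀ k → coeff (0ℚ ∷ p *ₚ q) k ≡ 0ℚ
  shifted zero    = refl
  shifted (suc k) = *ₚ-zeroˡ p q (λ k → deg-p (suc k) z<s) k
coeff-top-*ₚ (a ∷ p) q {suc d} {e} deg-p deg-q = begin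
  coeff ((a ∷ p) *ₚ q) (suc (d ℕ.+ e))
    ≡⟨ coeff-∷-*ₚ a p q (suc (d ℕ.+ e)) ⟩
  a ℚ.* coeff q (suc (d ℕ.+ e)) ℚ.+ coeff (p *ₚ q) (d ℕ.+ e)
    ≡⟨ cong₂ (λ x y → a ℚ.* x ℚ.+ y) (deg-q _ (s<s (ℕₚ.m≤n+m e d)))
             (coeff-top-*ₚ p q (λ k d<k → deg-p (suc k) (s<s d<k)) deg-q) ⟩
  a ℚ.* 0ℚ ℚ.+ coeff p d ℚ.* coeff q e
    ≡⟨ cong (ℚ._+ coeff p d ℚ.* coeff q e) (ℚₚ.*-zeroʳ a) ⟩
  0ℚ ℚ.+ coeff p d ℚ.* coeff q e
    ≡⟨ ℚₚ.+-identityˡ _ ⟩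
  coeff p d ℚ.* coeff q e ∎
  where open ≡-Reasoning

HasDegree : ℕ → Poly → Set
HasDegree d p = coeff p d ≢ 0ℚ × DegreeAtMost d p

-- Trailing zeros are allowed, so the length of the list does not give the degree. The last nonzero
-- coefficient is found from the tail inwards, using that equality with 0 is decidable in ℚ.
zero⊎degree : ∀ p → p ≈ₚ [] ⊎ ∃[ d ] HasDegree d p
zero⊎degree []      = inj₁ (λ k → refl)
zero⊎degree (a ∷ p) with zero⊎degree p | a ℚₚ.≟ 0ℚ
... | inj₂ (d , p[d]≢0 , deg) | _ =
  inj₂ (suc d , p[d]≢0 , λ { (suc k) (s<s d<k) → deg k d<k })
... | inj₁ p≈0 | no  a≢0 = inj₂ (0 , a≢0 , λ { (suc k) _ → p≈0 k })
... | inj₁ p≈0 | yes a≡0 = inj₁ λ { zero → a≡0 ; (suc k) → p≈0 k }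

p*q≢0 : ∀ {p q} → p ≢ 0ℚ → q ≢ 0ℚ → p ℚ.* q ≢ 0ℚ
p*q≢0 {p} {q} p≢0 q≢0 pq≡0 = q≢0 (begin
  q                    ≡⟨ ℚₚ.*-identityˡ q ⟨
  1ℚ ℚ.* q             ≡⟨ cong (ℚ._* q) (ℚₚ.*-inverseˡ p) ⟨
  ℚ.1/ p ℚ.* p ℚ.* q   ≡⟨ ℚₚ.*-assoc (ℚ.1/ p) p q ⟩
  ℚ.1/ p ℚ.* (p ℚ.* q) ≡⟨ cong (ℚ.1/ p ℚ.*_) pq≡0 ⟩
  ℚ.1/ p ℚ.* 0ℚ        ≡⟨ ℚₚ.*-zeroʳ (ℚ.1/ p) ⟩
  0ℚ                   ∎)
  where
  open ≡-Reasoning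
  instance _ = ℚ.≢-nonZero p≢0

coeff-*ₚ≢0 : ∀ p q {d e} → HasDegree d p → HasDegree e q → coeff (p *ₚ q) (d ℕ.+ e) ≢ 0ℚ
coeff-*ₚ≢0 p q (p[d]≢0 , deg-p) (q[e]≢0 , deg-q) eq =
  p*q≢0 p[d]≢0 q[e]≢0 (trans (sym (coeff-top-*ₚ p q deg-p deg-q)) eq)

linear-root : ∀ p → HasDegree 1 p → ∃[ r ] eval p r ≡ 0ℚ
linear-root p (b≢0 , deg) = r , (begin
  eval p r                         ≡⟨ eval-cong {p} {a ∷ b ∷ []} r p≈ ⟩
  a ℚ.+ r ℚ.* (b ℚ.+ r ℚ.* 0ℚ)
    ≡⟨ solve 3 (λ a b i → a :+ (:- (a :* i)) :* (b :+ (:- (a :* i)) :* con 0ℚ) := a :- a :* (i :* b))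
         refl a b (ℚ.1/ b) ⟩
  a ℚ.- a ℚ.* (ℚ.1/ b ℚ.* b)       ≡⟨ cong (λ x → a ℚ.- a ℚ.* x) (ℚₚ.*-inverseˡ b) ⟩
  a ℚ.- a ℚ.* 1ℚ                   ≡⟨ solve 1 (λ a → a :- a :* con 1ℚ := con 0ℚ) refl a ⟩
  0ℚ                               ∎)
  where
  open ≡-Reasoning
  open ℚSolver.+-*-Solver
  a = coeff p 0
  b = coeff p 1
  instance _ = ℚ.≢-nonZero b≢0
  r = ℚ.- (a ℚ.* ℚ.1/ b)
  p≈ : p ≈ₚ a ∷ b ∷ []
  p≈ 0             = refl
  p≈ 1             = refl
  p≈ (suc (suc k)) = deg (suc (suc k)) (s<s z<s)

constant-unit : ∀ p → HasDegree 0 p → p ∣ₚ (1ℚ ∷ [])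
constant-unit p (a≢0 , deg) = ℚ.1/ coeff p 0 ∷ [] , inverse
  where
  instance _ = ℚ.≢-nonZero a≢0
  inverse : (ℚ.1/ coeff p 0 ∷ []) *ₚ p ≈ₚ 1ℚ ∷ []
  inverse k = trans (coeff-∷-*ₚ (ℚ.1/ coeff p 0) [] p k) (scaled k)
    where
    scaled : ∀ k → ℚ.1/ coeff p 0 ℚ.* coeff p k ℚ.+ coeff (0ℚ ∷ []) k ≡ coeff (1ℚ ∷ []) k
    scaled zero    = trans (ℚₚ.+-identityʳ _) (ℚₚ.*-inverseˡ (coeff p 0))
    scaled (suc k) = trans (ℚₚ.+-identityʳ _)
      (trans (cong (ℚ.1/ coeff p 0 ℚ.*_) (deg (suc k) z<s)) (ℚₚ.*-zeroʳ (ℚ.1/ coeff p 0)))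

-- The degrees of two factors add up to 3, so one factor is constant, hence a unit, or linear, hence
-- the source of a rational root of `p`.
cubic-irreducible : ∀ p → HasDegree 3 p → (∀ r → eval p r ≢ 0ℚ) → Irreducible p
cubic-irreducible p deg-p@(p[3]≢0 , p≤3) rootless = record
  { p∤1 = non-unit ; split-∣1 = λ {x} {y} → split x y }
  where
  non-unit : ¬ (p ∣ₚ (1ℚ ∷ []))
  non-unit (q , qp≈1) with zero⊎degree q
  ... | inj₁ q≈0 = contradiction (trans (sym (qp≈1 0)) (*ₚ-zeroˡ q p q≈0 0)) λ()
  ... | inj₂ (d , deg-q) = coeff-*ₚ≢0 q p deg-q deg-p
    -- Commuting to `3 + d` exposes a successor, so the coefficient of the constant polynomial 1
    -- reduces to 0.
    (trans (qp≈1 (d ℕ.+ 3)) (cong (coeff (1ℚ ∷ [])) (ℕₚ.+-comm d 3)))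

  root-free : ∀ x y → p ≈ₚ x *ₚ y → ∀ r → eval x r ℚ.* eval y r ≢ 0ℚ
  root-free x y p≈xy r eq = rootless r (trans (eval-cong {p} {x *ₚ y} r p≈xy) (trans (eval-*ₚ x y r) eq))

  split : ∀ x y → p ≈ₚ x *ₚ y → x ∣ₚ (1ℚ ∷ []) ⊎ y ∣ₚ (1ℚ ∷ [])
  split x y p≈xy with zero⊎degree x | zero⊎degree y
  -- A zero factor would make `p` vanish everywhere; the point 0 serves as the forbidden root.
  ... | inj₁ x≈0 | _ = contradiction
    (trans (cong (ℚ._* eval y 0ℚ) (eval-zero x 0ℚ x≈0)) (ℚₚ.*-zeroˡ (eval y 0ℚ))) (root-free x y p≈xy 0ℚ)
  ... | inj₂ _ | inj₁ y≈0 = contradiction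
    (trans (cong (eval x 0ℚ ℚ.*_) (eval-zero y 0ℚ y≈0)) (ℚₚ.*-zeroʳ (eval x 0ℚ))) (root-free x y p≈xy 0ℚ)
  ... | inj₂ (0 , deg-x) | inj₂ _ = inj₁ (constant-unit x deg-x)
  ... | inj₂ _ | inj₂ (0 , deg-y) = inj₂ (constant-unit y deg-y)
  ... | inj₂ (1 , deg-x) | inj₂ _ = let r , x[r]≡0 = linear-root x deg-x in contradiction
    (trans (cong (ℚ._* eval y r) x[r]≡0) (ℚₚ.*-zeroˡ (eval y r))) (root-free x y p≈xy r)
  ... | inj₂ _ | inj₂ (1 , deg-y) = let r , y[r]≡0 = linear-root y deg-y in contradiction
    (trans (cong (eval x r ℚ.*_) y[r]≡0) (ℚₚ.*-zeroʳ (eval x r))) (root-free x y p≈xy r)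
  -- Two factors of degree at least 2 give the product a nonzero coefficient in degree at least 4.
  ... | inj₂ (suc (suc d) , deg-x) | inj₂ (suc (suc e) , deg-y) = contradiction
    (trans (sym (p≈xy _)) (p≤3 (suc (suc d) ℕ.+ suc (suc e)) 3<d+e)) (coeff-*ₚ≢0 x y deg-x deg-y)
    where
    3<d+e : 3 < suc (suc d) ℕ.+ suc (suc e)
    3<d+e = s<s (s<s (ℕₚ.≤-trans (s<s z<s) (ℕₚ.m≤n+m (suc (suc e)) d)))

-- The formulas are needed over ℤ and ℚ, over solver expressions (to prove identities between them),
-- and over rings of related pairs (to see that they preserve the relation).
module Formulas (R : RawRing 0ℓ 0ℓ) (ι : ℤ → RawRing.Carrier R) where
  open RawRing R
  open MatrixOps R

  -- The homogenised characteristic polynomial of A₀.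
  cubicForm : Carrier → Carrier → Carrier
  cubicForm n d =
    n * (n * (n + ι (ℤ.- + 31) * d) + ι (+ 59) * (d * d)) + ι (ℤ.- + 1) * (d * (d * d))

  -- The multiples of 7 are bracketed together, leaving 2m³ modulo 7.
  indexForm : Carrier → Carrier → Carrier
  indexForm s m = ι (+ 2) * (m * m * m) + ι (+ 7) * (s * s * s + - ι (+ 4) * (s * m * m))

  vec : Carrier → Carrier → Carrier → Fin 3 → Carrier
  vec p q r 0F = p
  vec p q r 1F = q
  vec p q r 2F = r

  fromRows : (u v w : Fin 3 → Carrier) → Matrix Carrier 3
  fromRows u v w 0F = u
  fromRows u v w 1F = v
  fromRows u v w 2F = w

  ιA₀ : Matrix Carrier 3
  ιA₀ i j = ι (A₀ i j)

  -- This is aI + sS + mB with B = A₀ - I and S = (B² - 28B)/2. The matrix S is integral although it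
  -- is only half of an element of ℤ[A₀].
  centralizer : (a s m : Carrier) → Matrix Carrier 3
  centralizer a s m = fromRows
    (vec a               (ι (+ 2) * m + - ι (+ 28) * s) (ι (+ 2) * s))
    (vec (- ι (+ 7) * s) a               (ι (+ 2) * m))
    (vec (- ι (+ 7) * m) (- ι (+ 7) * s) (a + ι (+ 28) * m))

  krylov : (Fin 3 → Carrier) → Matrix Carrier 3 → Matrix Carrier 3
  krylov x N = fromRows x (x ·N) (x ·N ·N)
    where
    infixl 7 _·N
    _·N : (Fin 3 → Carrier) → Fin 3 → Carrier
    -- The row vector times `N` is taken as a row of a matrix product, so that it unfolds exactly as
    -- a row of `X ⊗ N` does.
    x ·N = (fromRows x x x ⊗ N) 0F

  -- The cofactor of the index form in the determinant of krylov (vec p q r) (centralizer a s m).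
  covolume : (p q r : Carrier) → Carrier
  covolume p q r = det (fromRows
    (vec p q r)
    (vec (- ι (+ 7) * r) (ι (+ 2) * p) (ι (+ 2) * q + ι (+ 28) * r))
    (vec (- ι (+ 7) * q) (- ι (+ 28) * p + - ι (+ 7) * r) (ι (+ 2) * p)))

open Formulas ℤ.+-*-rawRing id
open Formulas ℚ.+-*-rawRing fromℤ using () renaming (cubicForm to cubicFormℚ)

-- Congruences

-- A formula evaluated in this ring returns its values at two congruent inputs together with a proof
-- that the values are congruent.
congruenceRing : ℤ → RawRing 0ℓ 0ℓ
congruenceRing k = record
  { Carrier = ∃[ i ] ∃[ j ] k ∣ i ℤ.- j
  ; _≈_     = _≡_
  ; _+_     = λ (i , j , k∣i-j) (i′ , j′ , k∣i′-j′) → i ℤ.+ i′ , j ℤ.+ j′ ,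
      subst (k ∣_) (S.solve 4 (λ i j i′ j′ → (i :- j) :+ (i′ :- j′) := (i :+ i′) :- (j :+ j′))
        refl i j i′ j′)
        (∣m∣n⇒∣m+n k∣i-j k∣i′-j′)
  ; _*_     = λ (i , j , k∣i-j) (i′ , j′ , k∣i′-j′) → i ℤ.* i′ , j ℤ.* j′ ,
      subst (k ∣_) (S.solve 4 (λ i j i′ j′ → i :* (i′ :- j′) :+ (i :- j) :* j′ := i :* i′ :- j :* j′)
        refl i j i′ j′)
        (∣m∣n⇒∣m+n (∣n⇒∣m*n i k∣i′-j′) (∣m⇒∣m*n j′ k∣i-j))
  ; -_      = λ (i , j , k∣i-j) → ℤ.- i , ℤ.- j ,
      subst (k ∣_) (S.solve 2 (λ i j → :- (i :- j) := :- i :- :- j) refl i j) (∣m⇒∣-m k∣i-j)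
  ; 0#      = + 0 , + 0 , divides (+ 0) refl
  ; 1#      = + 1 , + 1 , divides (+ 0) refl
  }
  where
  module S = ℤSolver.+-*-Solver
  open S using (_:+_; _:*_; _:-_; :-_; _:=_)

module Congruence (k : ℕ) .{{_ : ℕ.NonZero k}} where
  constant : ℤ → RawRing.Carrier (congruenceRing (+ k))
  constant i = i , i , divides (+ 0) (ℤₚ.+-inverseʳ i)

  residue : ∀ i → ∃[ r ] + k ∣ i ℤ.- + toℕ {k} r
  residue i = fromℕ< r<k , divides (i ℤDivMod./ℕ k) (begin
    i ℤ.- + toℕ (fromℕ< r<k)  ≡⟨ cong (λ r → i ℤ.- + r) (Finₚ.toℕ-fromℕ< r<k) ⟩
    i ℤ.- + r                 ≡⟨ cong (ℤ._- + r) (ℤDivMod.a≡a%ℕn+[a/ℕn]*n i k) ⟩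
    + r ℤ.+ q*k ℤ.- + r       ≡⟨ S.solve 2 (λ r x → r :+ x :- r := x) refl (+ r) q*k ⟩
    q*k                       ∎)
    where
    open ≡-Reasoning
    module S = ℤSolver.+-*-Solver
    open S using (_:+_; _:-_; _:=_)
    r = i ℤDivMod.%ℕ k
    r<k = ℤDivMod.n%ℕd<d i k
    q*k = i ℤDivMod./ℕ k ℤ.* + k

  related : ∀ i → RawRing.Carrier (congruenceRing (+ k))
  related i = i , + toℕ (proj₁ (residue i)) , proj₂ (residue i)

  open Formulas (congruenceRing (+ k)) constant public

-- Irreducibility of the characteristic polynomial

fromℤ-+ : ∀ i j → fromℤ (i ℤ.+ j) ≡ fromℤ i ℚ.+ fromℤ j
fromℤ-+ i j = ℚₚ.toℚᵘ-injective (ℚᵘₚ.≃-trans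
  (ℚᵘ.*≡* (cong (ℤ._* + 1) (cong₂ ℤ._+_ (sym (ℤₚ.*-identityʳ i)) (sym (ℤₚ.*-identityʳ j)))))
  (ℚᵘₚ.≃-sym (ℚₚ.toℚᵘ-homo-+ (fromℤ i) (fromℤ j))))

fromℤ-* : ∀ i j → fromℤ (i ℤ.* j) ≡ fromℤ i ℚ.* fromℤ j
fromℤ-* i j = ℚₚ.toℚᵘ-injective (ℚᵘₚ.≃-sym (ℚₚ.toℚᵘ-homo-* (fromℤ i) (fromℤ j)))

clear-denominator : ∀ r → r ℚ.* fromℤ (ℚ.↧ r) ≡ fromℤ (ℚ.↥ r)
clear-denominator r@record{} = ℚₚ.toℚᵘ-injective (ℚᵘₚ.≃-trans
  (ℚₚ.toℚᵘ-homo-* r (fromℤ (ℚ.↧ r)))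
  (ℚᵘ.*≡* (ℤₚ.*-assoc (ℚ.↥ r) (ℚ.↧ r) (+ 1))))

cubic : Poly
cubic = fromℤ (ℤ.- + 1) ∷ fromℤ (+ 59) ∷ fromℤ (ℤ.- + 31) ∷ 1ℚ ∷ []

fromℤ-‿- : ∀ i → fromℤ (ℤ.- i) ≡ ℚ.- fromℤ i
fromℤ-‿- (+ zero)    = refl
fromℤ-‿- (+ (suc n)) = refl
fromℤ-‿- -[1+ n ]    = refl

-- Evaluating a form in the graph of fromℤ shows that fromℤ commutes with it.
graphRing : RawRing 0ℓ 0ℓ
graphRing = record
  { Carrier = ∃[ i ] ∃[ p ] fromℤ i ≡ p
  ; _≈_     = _≡_
  ; _+_     = λ (i , p , i≡p) (j , q , j≡q) →
      i ℤ.+ j , p ℚ.+ q , trans (fromℤ-+ i j) (cong₂ ℚ._+_ i≡p j≡q)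
  ; _*_     = λ (i , p , i≡p) (j , q , j≡q) →
      i ℤ.* j , p ℚ.* q , trans (fromℤ-* i j) (cong₂ ℚ._*_ i≡p j≡q)
  ; -_      = λ (i , p , i≡p) → ℤ.- i , ℚ.- p , trans (fromℤ-‿- i) (cong ℚ.-_ i≡p)
  ; 0#      = + 0 , 0ℚ , refl
  ; 1#      = + 1 , 1ℚ , refl
  }

fromℤ-cubicForm : ∀ n d → fromℤ (cubicForm n d) ≡ cubicFormℚ (fromℤ n) (fromℤ d)
fromℤ-cubicForm n d = proj₂ (proj₂ (graphForm (graph n) (graph d)))
  where
  graph : ℤ → RawRing.Carrier graphRing
  graph i = i , fromℤ i , refl
  open Formulas graphRing graph using () renaming (cubicForm to graphForm)

-- Multiplying the value at r = n/d by d³ clears the denominators and turns it into the homogeneous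
-- form in n and d. Taking numerators then carries the equality from ℚ back to ℤ.
root⇒cubicForm≡0 : ∀ r → eval cubic r ≡ 0ℚ → cubicForm (ℚ.↥ r) (ℚ.↧ r) ≡ + 0
root⇒cubicForm≡0 r P[r]≡0 = cong ℚ.↥_ (begin
  fromℤ (cubicForm (ℚ.↥ r) (ℚ.↧ r)) ≡⟨ fromℤ-cubicForm (ℚ.↥ r) (ℚ.↧ r) ⟩
  cubicFormℚ (fromℤ (ℚ.↥ r)) d      ≡⟨ cong (λ n → cubicFormℚ n d) (clear-denominator r) ⟨
  cubicFormℚ (r ℚ.* d) d
    ≡⟨ solve 2 (λ r d →
         cubicForm′ (r :* d) d
         := d :* (d :* d) :* (con (fromℤ (ℤ.- + 1)) :+ r :* (con (fromℤ (+ 59)) :+ r :*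
              (con (fromℤ (ℤ.- + 31)) :+ r :* (con 1ℚ :+ r :* con 0ℚ)))))
         refl r d ⟩
  d ℚ.* (d ℚ.* d) ℚ.* eval cubic r  ≡⟨ cong (d ℚ.* (d ℚ.* d) ℚ.*_) P[r]≡0 ⟩
  d ℚ.* (d ℚ.* d) ℚ.* 0ℚ            ≡⟨ ℚₚ.*-zeroʳ (d ℚ.* (d ℚ.* d)) ⟩
  0ℚ                                ∎)
  where
  open ≡-Reasoning
  open ℚSolver.+-*-Solver
  d  = fromℤ (ℚ.↧ r)
  cubicForm′ : ∀ {n} → Polynomial n → Polynomial n → Polynomial n
  cubicForm′ {n} = Formulas.cubicForm
    record
      { Carrier = Polynomial n ; _≈_ = _≡_ ; _+_ = _:+_ ; _*_ = _:*_ ; -_ = :-_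
      ; 0# = con 0ℚ ; 1# = con 1ℚ
      } (λ i → con (fromℤ i))

-- Modulo 3 the form is n³ - n²d - nd² - d³, which has no zero on the projective line over the field
-- of three elements; all nine pairs of residues are tested. The leading 0 stands for the value of
-- the form at the hypothetical integer zero.
cubicForm-anisotropic : ∀ (r s : Fin 3) →
  + 3 ∣ + 0 ℤ.- cubicForm (+ toℕ r) (+ toℕ s) → r ≡ zero × s ≡ zero
cubicForm-anisotropic = from-yes (Finₚ.all? {3} λ r → Finₚ.all? {3} λ s →
  (+ 3 ∣? + 0 ℤ.- cubicForm (+ toℕ r) (+ toℕ s)) →-dec ((r Finₚ.≟ zero {2}) ×-dec (s Finₚ.≟ zero {2})))

cubicForm≡0⇒3∣ : ∀ n d → cubicForm n d ≡ + 0 → + 3 ∣ n × + 3 ∣ d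
cubicForm≡0⇒3∣ n d form≡0 =
  residue≡0⇒3∣ n (proj₁ residues≡0) , residue≡0⇒3∣ d (proj₂ residues≡0)
  where
  module C = Congruence 3
  r = proj₁ (C.residue n)
  s = proj₁ (C.residue d)

  3∣form : + 3 ∣ cubicForm n d ℤ.- cubicForm (+ toℕ r) (+ toℕ s)
  3∣form = proj₂ (proj₂ (C.cubicForm (C.related n) (C.related d)))

  residues≡0 : r ≡ zero × s ≡ zero
  residues≡0 = cubicForm-anisotropic r s
    (subst (λ i → + 3 ∣ i ℤ.- cubicForm (+ toℕ r) (+ toℕ s)) form≡0 3∣form)

  residue≡0⇒3∣ : ∀ i → proj₁ (C.residue i) ≡ zero → + 3 ∣ i
  residue≡0⇒3∣ i r≡0 = subst (+ 3 ∣_) (ℤₚ.+-identityʳ i)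
    (subst (λ r → + 3 ∣ i ℤ.- + toℕ r) r≡0 (proj₂ (C.residue i)))

-- By anisotropy modulo 3, a root would have numerator and denominator both divisible by 3, against
-- lowest terms.
cubic-rootless : ∀ r → eval cubic r ≢ 0ℚ
cubic-rootless r@(mkℚ _ _ coprime) P[r]≡0 =
  let 3∣n , 3∣d = cubicForm≡0⇒3∣ (ℚ.↥ r) (ℚ.↧ r) (root⇒cubicForm≡0 r P[r]≡0)
  -- The coprimality proof inside a rational is irrelevant, so it is recomputed before it can yield
  -- the absurd 3 ≡ 1.
  in contradiction (Coprimality.recompute coprime (∣⇒∣ᵤ 3∣n , ∣⇒∣ᵤ 3∣d)) λ()

charPoly-A₀ : charPoly A₀ ≈ₚ cubic
charPoly-A₀ 0 = refl
charPoly-A₀ 1 = refl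
charPoly-A₀ 2 = refl
charPoly-A₀ 3 = refl
charPoly-A₀ (suc (suc (suc (suc k)))) = refl

charPoly-A₀-irreducible : Irreducible (charPoly A₀)
charPoly-A₀-irreducible = cubic-irreducible (charPoly A₀)
  ((λ ()) , λ { (suc (suc (suc (suc k)))) _ → refl ; 1 (s<s ()) ; 2 (s<s (s<s ())) ; 3 (s<s (s<s (s<s ()))) })
  λ r P[r]≡0 → cubic-rootless r (trans (sym (eval-cong {charPoly A₀} {cubic} r charPoly-A₀)) P[r]≡0)

-- The index form

-- The form takes only the values 0, 2 and 5 modulo 7, whereas the units are 1 and 6. All 49 pairs
-- of residues are tested, once for each unit.
indexForm-residue-nonunit : ∀ (r t : Fin 7) {i} → ℤ.∣ i ∣ ≡ 1 → ¬ + 7 ∣ i ℤ.- indexForm (+ toℕ r) (+ toℕ t)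
indexForm-residue-nonunit r t {+ 1}      refl = from-yes (Finₚ.all? {7} λ r → Finₚ.all? {7} λ t →
  ¬? (+ 7 ∣? + 1 ℤ.- indexForm (+ toℕ r) (+ toℕ t))) r t
indexForm-residue-nonunit r t { -[1+ 0 ]} refl = from-yes (Finₚ.all? {7} λ r → Finₚ.all? {7} λ t →
  ¬? (+ 7 ∣? -[1+ 0 ] ℤ.- indexForm (+ toℕ r) (+ toℕ t))) r t

indexForm-nonunit : ∀ s m → ℤ.∣ indexForm s m ∣ ≢ 1
indexForm-nonunit s m ∣F∣≡1 = indexForm-residue-nonunit r t {indexForm s m} ∣F∣≡1 7∣difference
  where
  module C = Congruence 7
  r = proj₁ (C.residue s)
  t = proj₁ (C.residue m)

  7∣difference : + 7 ∣ indexForm s m ℤ.- indexForm (+ toℕ r) (+ toℕ t)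
  7∣difference = proj₂ (proj₂ (C.indexForm (C.related s) (C.related m)))

-- Integer matrices

open ℤMat
module Σℤ = SemiringSum ℤₚ.+-*-semiring
open SemiringDefs (RawRing.rawSemiring ℤ.+-*-rawRing) using (_^_)

det-cong : ∀ {n} {A B : Matrix ℤ n} → A ≋ B → det A ≡ det B
det-cong {zero}  A≋B = refl
det-cong {suc n} A≋B = Σℤ.sum-cong-≗ λ j →
  cong₂ (λ x y → (ℤ.- + 1) ^ toℕ j ℤ.* (x ℤ.* y)) (A≋B zero j) (det-cong λ r c → A≋B (suc r) (punchIn j c))

⊗-cong : ∀ {n} {A A′ B B′ : Matrix ℤ n} → A ≋ A′ → B ≋ B′ → A ⊗ B ≋ A′ ⊗ B′
⊗-cong A≋ B≋ i j = Σℤ.sum-cong-≗ λ k → cong₂ ℤ._*_ (A≋ i k) (B≋ k j)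

⊗-assoc : ∀ {n} (A B C : Matrix ℤ n) → (A ⊗ B) ⊗ C ≋ A ⊗ (B ⊗ C)
⊗-assoc {n} A B C i j = begin
  ∑[ k < n ] (∑[ l < n ] (A i l ℤ.* B l k) ℤ.* C k j)
    ≡⟨ sum-cong-≗ (λ k → *-distribʳ-sum (C k j) (λ l → A i l ℤ.* B l k)) ⟩
  ∑[ k < n ] ∑[ l < n ] (A i l ℤ.* B l k ℤ.* C k j)
    ≡⟨ ∑-comm (λ k l → A i l ℤ.* B l k ℤ.* C k j) ⟩
  ∑[ l < n ] ∑[ k < n ] (A i l ℤ.* B l k ℤ.* C k j)
    ≡⟨ sum-cong-≗ (λ l → sum-cong-≗ λ k → ℤₚ.*-assoc (A i l) (B l k) (C k j)) ⟩
  ∑[ l < n ] ∑[ k < n ] (A i l ℤ.* (B l k ℤ.* C k j))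
    ≡⟨ sum-cong-≗ (λ l → *-distribˡ-sum (A i l) (λ k → B l k ℤ.* C k j)) ⟨
  ∑[ l < n ] (A i l ℤ.* ∑[ k < n ] (B l k ℤ.* C k j)) ∎
  where
  open Σℤ
  open ≡-Reasoning

∑-Idˡ : ∀ {n} (i : Fin n) (v : Fin n → ℤ) → Σℤ.sum (λ k → Id i k ℤ.* v k) ≡ v i
∑-Idˡ {suc n} zero v = begin
  + 1 ℤ.* v zero ℤ.+ Σℤ.sum (λ k → + 0 ℤ.* v (suc k))
    ≡⟨ cong₂ ℤ._+_ (ℤₚ.*-identityˡ (v zero)) (sym (Σℤ.*-distribˡ-sum (+ 0) (v ∘ suc))) ⟩
  v zero ℤ.+ + 0
    ≡⟨ ℤₚ.+-identityʳ (v zero) ⟩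
  v zero ∎
  where open ≡-Reasoning
∑-Idˡ (suc i) v = trans (ℤₚ.+-identityˡ _) (∑-Idˡ i (v ∘ suc))

Id-sym : ∀ {n} (i j : Fin n) → Id i j ≡ Id j i
Id-sym zero    zero    = refl
Id-sym zero    (suc _) = refl
Id-sym (suc _) zero    = refl
Id-sym (suc i) (suc j) = Id-sym i j

⊗-identityˡ : ∀ {n} (A : Matrix ℤ n) → Id ⊗ A ≋ A
⊗-identityˡ A i j = ∑-Idˡ i (λ k → A k j)

⊗-identityʳ : ∀ {n} (A : Matrix ℤ n) → A ⊗ Id ≋ A
⊗-identityʳ A i j = trans
  (Σℤ.sum-cong-≗ λ k → trans (ℤₚ.*-comm (A i k) (Id k j)) (cong (ℤ._* A i k) (Id-sym k j)))
  (∑-Idˡ j (A i))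

⊗-monoid : ℕ → Monoid 0ℓ 0ℓ
⊗-monoid n = record
  { Carrier  = Matrix ℤ n
  ; _≈_      = _≋_
  ; _∙_      = _⊗_
  ; ε        = Id
  ; isMonoid = record
    { isSemigroup = record
      { isMagma = record
        { isEquivalence = record
          { refl  = λ i j → refl
          ; sym   = λ p i j → sym (p i j)
          ; trans = λ p q i j → trans (p i j) (q i j)
          }
        ; ∙-cong = ⊗-cong
        }
      ; assoc = ⊗-assoc
      }
    ; identity = ⊗-identityˡ , ⊗-identityʳ
    }
  }

-- Conjugation in a monoid

module Conjugation {c ℓ} (M : Monoid c ℓ) where
  open Monoid M hiding (refl; sym; trans)
  open SetoidReasoning setoid
  open MonoidProperties M using (insertˡ; cancelˡ; cancelʳ)

  -- Conjugating back by `y` takes `x ∙ a ∙ y` to `a` and `b` to `y ∙ b ∙ x`, and it preserves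
  -- commutation. The factor `y ∙ x` is inserted on the left and cancelled on the right.
  conjugate-commute : ∀ {x y a b} → x ∙ y ≈ ε → y ∙ x ≈ ε →
    (x ∙ a ∙ y) ∙ b ≈ b ∙ (x ∙ a ∙ y) →
    a ∙ (y ∙ b ∙ x) ≈ (y ∙ b ∙ x) ∙ a
  conjugate-commute {x} {y} {a} {b} xy≈ε yx≈ε comm = begin
    a ∙ (y ∙ b ∙ x)                  ≈⟨ insertˡ yx≈ε _ ⟩
    y ∙ (x ∙ (a ∙ (y ∙ b ∙ x)))      ≈⟨ MonoidSolver.solve M ⟩
    y ∙ (((x ∙ a ∙ y) ∙ b) ∙ x)      ≈⟨ ∙-congˡ (∙-congʳ comm) ⟩
    y ∙ ((b ∙ (x ∙ a ∙ y)) ∙ x)      ≈⟨ MonoidSolver.solve M ⟩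
    (y ∙ b) ∙ (((x ∙ a) ∙ y) ∙ x)    ≈⟨ ∙-congˡ (cancelʳ yx≈ε (x ∙ a)) ⟩
    (y ∙ b) ∙ (x ∙ a)                ≈⟨ assoc (y ∙ b) x a ⟨
    (y ∙ b ∙ x) ∙ a                  ∎

  conjugate-intertwine : ∀ {x y} b → x ∙ y ≈ ε → x ∙ (y ∙ b ∙ x) ≈ b ∙ x
  conjugate-intertwine {x} {y} b xy≈ε = begin
    x ∙ (y ∙ b ∙ x)    ≈⟨ ∙-congˡ (assoc y b x) ⟩
    x ∙ (y ∙ (b ∙ x))  ≈⟨ cancelˡ xy≈ε (b ∙ x) ⟩
    b ∙ x              ∎

-- The commutant of A₀

open ℤSolver.+-*-Solver hiding (solve)
open GroupProperties (AbelianGroup.group ℤₚ.+-0-abelianGroup) using (∙-cancelʳ)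
module ℤSolve = ℤSolver.+-*-Solver

exprRing : ℕ → RawRing 0ℓ 0ℓ
exprRing n = record
  { Carrier = Polynomial n
  ; _≈_     = _≡_
  ; _+_     = _:+_
  ; _*_     = _:*_
  ; -_      = :-_
  ; 0#      = con (+ 0)
  ; 1#      = con (+ 1)
  }

module ExprMat {n} = MatrixOps (exprRing n)
module Expr {n} = Formulas (exprRing n) con

-- The combination is built as a solver expression, so that each certificate below is checked by
-- normalisation.
combination : ∀ {n} → List (ℤ × Fin 3 × Fin 3) → Matrix (Polynomial n) 3 → Polynomial n
combination []                 P = con (+ 0)
combination ((c , i , j) ∷ cs) P = con c :* P i j :+ combination cs P

combination-cong : ∀ {n} {P Q : Matrix (Polynomial n) 3} {ρ} cs →
  (∀ i j → ⟦ P i j ⟧ ρ ≡ ⟦ Q i j ⟧ ρ) → ⟦ combination cs P ⟧ ρ ≡ ⟦ combination cs Q ⟧ ρ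
combination-cong []                 P≗Q = refl
combination-cong ((c , i , j) ∷ cs) P≗Q = cong₂ (λ x y → c ℤ.* x ℤ.+ y) (P≗Q i j) (combination-cong cs P≗Q)

module _ (N : Matrix ℤ 3) (comm : Commute A₀ N) where
  private
    -- The nine entries of `N` become the solver variables, entry (i, j) at position 3i + j.
    ρ : Vec ℤ 9
    ρ = Vec.tabulate (λ k → uncurry N (Fin.remQuot 3 k))

    ν : Matrix (Polynomial 9) 3
    ν i j = var (Fin.combine i j)

    ⟦ν⟧ : (λ i j → ⟦ ν i j ⟧ ρ) ≋ N
    ⟦ν⟧ i j = trans
      (Vecₚ.lookup∘tabulate (uncurry N ∘ Fin.remQuot 3) (Fin.combine i j))
      (cong (uncurry N) (Finₚ.remQuot-combine i j))

    AN NA : Matrix (Polynomial 9) 3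
    AN = Expr.ιA₀ ExprMat.⊗ ν
    NA = ν ExprMat.⊗ Expr.ιA₀

    ⟦AN⟧≋⟦NA⟧ : ∀ i j → ⟦ AN i j ⟧ ρ ≡ ⟦ NA i j ⟧ ρ
    ⟦AN⟧≋⟦NA⟧ i j = trans (⊗-cong {A = A₀} (λ _ _ → refl) ⟦ν⟧ i j)
      (trans (comm i j) (sym (⊗-cong {B = A₀} ⟦ν⟧ (λ _ _ → refl) i j)))

    sᴺ mᴺ : Polynomial 9
    -- In the centralizer the entries used here are -7s and 2s, and likewise -7m and 2m. Since 7 - 3
    -- · 2 = 1, both coordinates are integer combinations of entries.
    sᴺ = :- (ν 1F 0F :+ con (+ 3) :* ν 0F 2F)
    mᴺ = :- (ν 2F 0F :+ con (+ 3) :* ν 1F 2F)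

    Nˢᵐ : Matrix (Polynomial 9) 3
    Nˢᵐ = Expr.centralizer (ν 0F 0F) sᴺ mᴺ

    -- cs lists the coefficients with which k (N - Nˢᵐ) i j is a combination of the entries of
    -- A₀ N - N A₀; the terms are distributed over both sides to avoid subtraction.
    certificate : ∀ i j (k : ℤ) .{{_ : ℤ.NonZero k}} cs →
      ⟦ con k :* ν i j :+ combination cs NA ⟧↓ ρ ≡ ⟦ con k :* Nˢᵐ i j :+ combination cs AN ⟧↓ ρ →
      ⟦ ν i j ⟧ ρ ≡ ⟦ Nˢᵐ i j ⟧ ρ
    certificate i j k cs eq = ℤₚ.*-cancelˡ-≡ k _ _ (∙-cancelʳ _ _ _ (trans
      (prove ρ (con k :* ν i j :+ combination cs NA) (con k :* Nˢᵐ i j :+ combination cs AN) eq)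
      (cong (ℤ._+_ (k ℤ.* ⟦ Nˢᵐ i j ⟧ ρ)) (combination-cong cs ⟦AN⟧≋⟦NA⟧))))

    N≋Nˢᵐ : N ≋ centralizer (N 0F 0F) (⟦ sᴺ ⟧ ρ) (⟦ mᴺ ⟧ ρ)
    N≋Nˢᵐ 0F 0F = refl
    -- The entries 2 of A₀ put a factor 2 into some of the relations, such as 2(N₁₁ - N₀₀) = 0; in
    -- those cases twice the difference is certified and the 2 is cancelled.
    N≋Nˢᵐ 0F 1F = certificate 0F 1F (+ 2)
      ((ℤ.- + 1 , 0F , 2F) ∷ (+ 2 , 1F , 0F) ∷ (ℤ.- + 28 , 0F , 0F) ∷ []) refl
    N≋Nˢᵐ 0F 2F = certificate 0F 2F (+ 1) ((+ 1 , 0F , 0F) ∷ []) refl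
    N≋Nˢᵐ 1F 0F = certificate 1F 0F (+ 1) ((ℤ.- + 3 , 0F , 0F) ∷ []) refl
    N≋Nˢᵐ 1F 1F = certificate 1F 1F (+ 2) ((+ 1 , 0F , 1F) ∷ []) refl
    N≋Nˢᵐ 1F 2F = certificate 1F 2F (+ 1) ((+ 1 , 1F , 0F) ∷ []) refl
    N≋Nˢᵐ 2F 0F = certificate 2F 0F (+ 1) ((ℤ.- + 3 , 1F , 0F) ∷ []) refl
    N≋Nˢᵐ 2F 1F = certificate 2F 1F (+ 2) ((+ 1 , 1F , 1F) ∷ (ℤ.- + 6 , 0F , 0F) ∷ []) refl
    N≋Nˢᵐ 2F 2F = certificate 2F 2F (+ 2)
      ((+ 1 , 1F , 2F) ∷ (+ 1 , 0F , 1F) ∷ (+ 28 , 1F , 0F) ∷ []) refl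

  commutant : ∃[ a ] ∃[ s ] ∃[ m ] N ≋ centralizer a s m
  commutant = N 0F 0F , ⟦ sᴺ ⟧ ρ , ⟦ mᴺ ⟧ ρ , N≋Nˢᵐ

-- Krylov determinants and the contradiction

krylov-cong : ∀ {x y : Fin 3 → ℤ} {N P : Matrix ℤ 3} → (∀ i → x i ≡ y i) → N ≋ P →
  krylov x N ≋ krylov y P
krylov-cong x≗y N≋P 0F j = x≗y j
krylov-cong x≗y N≋P 1F j = Σℤ.sum-cong-≗ λ k → cong₂ ℤ._*_ (x≗y k) (N≋P k j)
krylov-cong x≗y N≋P 2F j = Σℤ.sum-cong-≗ λ k → cong₂ ℤ._*_ (krylov-cong x≗y N≋P 1F k) (N≋P k j)

-- The first two rows of the Frobenius matrix are shifts: they send X to its second and third rows.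
-- Hence each row of `X` after the first is the preceding row times `N`.
intertwined-krylov : ∀ a₁ a₂ a₃ {X N : Matrix ℤ 3} → X ⊗ N ≋ frobenius a₁ a₂ a₃ ⊗ X →
  X ≋ krylov (X 0F) N
intertwined-krylov a₁ a₂ a₃ {X} {N} XN≋MX 0F j = refl
intertwined-krylov a₁ a₂ a₃ {X} {N} XN≋MX 1F j = trans
  (ℤSolve.solve 3 (λ x y z → y := con (+ 0) :* x :+ (con (+ 1) :* y :+ (con (+ 0) :* z :+ con (+ 0))))
    refl (X 0F j) (X 1F j) (X 2F j))
  (sym (XN≋MX 0F j))
intertwined-krylov a₁ a₂ a₃ {X} {N} XN≋MX 2F j = trans
  (ℤSolve.solve 3 (λ x y z → z := con (+ 0) :* x :+ (con (+ 0) :* y :+ (con (+ 1) :* z :+ con (+ 0))))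
    refl (X 0F j) (X 1F j) (X 2F j))
  (trans (sym (XN≋MX 1F j))
    (Σℤ.sum-cong-≗ λ k → cong (ℤ._* N k j) (intertwined-krylov a₁ a₂ a₃ {X} {N} XN≋MX 1F k)))

-- With B and S as in `centralizer`, B² = 28B + 2S, BS = -14I and S² = 196I - 7B. So, up to
-- multiples of I and N, the matrices N and N² have coordinates (m, s) and (28m² - 7s², 2m²) in the
-- basis B, S. The determinant of these coordinates is the index form, and `covolume` is the
-- determinant with rows x, xB, xS.
det-krylov-vec : ∀ a s m p q r →
  det (krylov (vec p q r) (centralizer a s m)) ≡ indexForm s m ℤ.* covolume p q r
det-krylov-vec = ℤSolve.solve 6 (λ a s m p q r →
  ExprMat.det (Expr.krylov (Expr.vec p q r) (Expr.centralizer a s m)) :=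
  Expr.indexForm s m :* Expr.covolume p q r) refl

-- The solver identity concerns explicit components, and `x` agrees with the `vec` of its components
-- only pointwise; congruence of the determinant bridges the two.
det-krylov : ∀ a s m x →
  det (krylov x (centralizer a s m)) ≡ indexForm s m ℤ.* covolume (x 0F) (x 1F) (x 2F)
det-krylov a s m x = trans
  (det-cong (krylov-cong {x} {vec (x 0F) (x 1F) (x 2F)} {centralizer a s m}
    (λ { 0F → refl ; 1F → refl ; 2F → refl }) (λ _ _ → refl)))
  (det-krylov-vec a s m (x 0F) (x 1F) (x 2F))

i*j≡1⇒∣i∣≡1 : ∀ i j → i ℤ.* j ≡ + 1 → ℤ.∣ i ∣ ≡ 1
i*j≡1⇒∣i∣≡1 i j ij≡1 = ℕₚ.m*n≡1⇒m≡1 ℤ.∣ i ∣ ℤ.∣ j ∣ (trans (sym (ℤₚ.abs-* i j)) (cong ℤ.∣_∣ ij≡1))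

det-krylov≢1 : ∀ {x N} → Commute A₀ N → det (krylov x N) ≢ + 1
det-krylov≢1 {x} {N} AN≋NA det≡1 with commutant N AN≋NA
... | a , s , m , N≋ = indexForm-nonunit s m
  (i*j≡1⇒∣i∣≡1 (indexForm s m) (covolume (x 0F) (x 1F) (x 2F)) (begin
    indexForm s m ℤ.* covolume (x 0F) (x 1F) (x 2F)
      ≡⟨ det-krylov a s m x ⟨
    det (krylov x (centralizer a s m))
      ≡⟨ det-cong {A = krylov x N} {krylov x (centralizer a s m)}
           (krylov-cong {x} {x} {N} {centralizer a s m} (λ _ → refl) N≋) ⟨
    det (krylov x N)
      ≡⟨ det≡1 ⟩
    + 1 ∎))
  where open ≡-Reasoning

A₀-not-frobeniusType : (irr : Irreducible (charPoly A₀)) → ¬ FrobeniusType (A₀ , irr)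
A₀-not-frobeniusType _
  (a₁ , a₂ , a₃ , X , X⁻¹ , detX≡1 , (XX⁻¹≋Id , X⁻¹X≋Id) , XAX⁻¹-commutes) =
  det-krylov≢1 {X 0F} {N}
    (conjugate-commute {X} {X⁻¹} {A₀} {M} XX⁻¹≋Id X⁻¹X≋Id XAX⁻¹-commutes)
    (trans (sym (det-cong {A = X} {krylov (X 0F) N}
      (intertwined-krylov a₁ a₂ a₃ {X} {N} (conjugate-intertwine {X} {X⁻¹} M XX⁻¹≋Id)))) detX≡1)
  where
  open Conjugation (⊗-monoid 3)
  M N : Matrix ℤ 3
  M = frobenius a₁ a₂ a₃
  N = X⁻¹ ⊗ M ⊗ X

mainTheorem6 : Σ[ irr ∈ Irreducible (charPoly A₀) ] ¬ FrobeniusType (A₀ , irr)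
mainTheorem6 = charPoly-A₀-irreducible , A₀-not-frobeniusType charPoly-A₀-irreducible
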